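{- Let $A$ be a finite set with $|A|\ge2$, let $n\ge2$ and $m\ge1$. For any transformation $f$ of $A^n$ and any $e=(e_1,\dots,e_m)\in A^m$, let $h^e$ be the transformation of $A^{n+m}$ with $h^e\in D(f,m)$ and $h^e_{n+i}(x)=e_i$ for all $1\le i\le m$ and all $x\in A^{n+m}$. Then $$\mathcal{L}(h^e)=\mathcal{L}(f|m)+m.$$
   Context: For $N\ge1$, a transformation of $A^N$ is a map $h=(h_1,\dots,h_N):A^N\to A^N$; its coordinate function $h_i:A^N\to A$ is trivial if $h_i(x)=x_i$ for all $x$. An instruction of $A^N$ is a transformation of $A^N$ with at most one nontrivial coordinate function. A program of length $L$ computing $h$ is a sequence of instructions $g^1,\dots,g^L$ of $A^N$ with $h=g^L\circ\cdots\circ g^1$. The procedural complexity $\mathcal{L}(h)$ is the shortest length of a program computing $h$; the identity has procedural complexity $0$. For a transformation $f$ of $A^n$, $D(f,m)$ is the set of transformations $h$ of $A^{n+m}$ such that $h_i(x_1,\dots,x_{n+m})=f_i(x_1,\dots,x_n)$ for all $1\le i\le n$ and all $(x_1,\dots,x_{n+m})\in A^{n+m}$. The shortest length of a program computing $f$ using $m$ memory cells is $\mathcal{L}(f|m):=\min_{h\in D(f,m)}\mathcal{L}(h)$. -}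

module Defs where

open import Data.Fin.Base using (Fin; _↑ˡ_)
open import Data.List.Base using (List; []; _∷_; length)
open import Data.Nat.Base using (ℕ; _+_; _≤_)
open import Data.Product.Base using (Σ; ∃; _×_; _,_; proj₁)
open import Data.Vec.Base using (Vec; lookup; take)
open import Function.Base using (id; _∘_)
open import Level using (Level)
open import Relation.Binary.PropositionalEquality using (_≡_; _≗_)
open import Relation.Nullary.Negation using (¬_)

private
  variable
    a : Level
    A : Set a
    N n : ℕ

Transformation : Set a → ℕ → Set a
Transformation A N = Vec A N → Vec A N

coordinate : Transformation A N → Fin N → Vec A N → A
coordinate h i x = lookup (h x) i

Trivial : Transformation A N → Fin N → Set _
Trivial h i = ∀ x → coordinate h i x ≡ lookup x i

-- At most one nontrivial coordinate; in particular the identity is an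
-- instruction.
IsInstruction : Transformation A N → Set _
IsInstruction g = ∀ i j → ¬ Trivial g i → ¬ Trivial g j → i ≡ j

Instruction : Set a → ℕ → Set a
Instruction A N = Σ (Transformation A N) IsInstruction

Program : Set a → ℕ → Set a
Program A N = List (Instruction A N)

-- The head of the list is executed first:
-- run (g¹ ∷ … ∷ gᴸ ∷ []) = gᴸ ∘ … ∘ g¹.
run : Program A N → Transformation A N
run []            = id
run ((g , _) ∷ p) = run p ∘ g

-- Transformations are compared pointwise, as function extensionality is not
-- available.
_Computes_ : Program A N → Transformation A N → Set _
p Computes h = run p ≗ h

IsMinimum : ∀ {ℓ} → (ℕ → Set ℓ) → ℕ → Set ℓ
IsMinimum P l = P l × (∀ k → P k → l ≤ k)

-- 𝓛[ h ]≡ l asserts that the minimum defining 𝓛(h) exists and equals l.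
-- There is at most one such l.
𝓛[_]≡_ : Transformation A N → ℕ → Set _
𝓛[_]≡_ {A = A} {N = N} h =
  IsMinimum λ l → Σ (Program A N) λ p → length p ≡ l × p Computes h

D : Transformation A n → (m : ℕ) → Transformation A (n + m) → Set _
D {n = n} f m h = ∀ (i : Fin n) x → coordinate h (i ↑ˡ m) x ≡ coordinate f i (take n x)

-- 𝓛[ f ∣ m ]≡ l asserts that the minimum of 𝓛(h) over h ∈ D(f,m) exists and
-- equals l.
𝓛[_∣_]≡_ : Transformation A n → ℕ → ℕ → Set _
𝓛[ f ∣ m ]≡ l = IsMinimum (λ k → ∃ λ h → D f m h × 𝓛[ h ]≡ k) l

{-# OPTIONS --safe #-}

-- Upper bound: after a program for some h ∈ D(f,m), overwrite the m memory
-- cells by e₁, …, e_m.  Lower bound: in a program for hᵉ every memory cell is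
-- written at least once, as |A| ≥ 2.  Behind the last write to the cell n + i
-- this cell contains eᵢ whatever the input was, so that this write can be
-- deleted if the later instructions read the constant eᵢ instead of the cell.
-- The other coordinates do not notice; doing this for all memory cells leaves a
-- program for an element of D(f,m) that is shorter by m.
--
-- The minimum 𝓛(f|m) exists because programs of a given length can be searched
-- exhaustively, up to pointwise equality, and because some program is found:
-- set the memory to z, then move (v , z) to (f v , z′), with z′ ≢ z, for one v
-- after the other.

module Submission where

open import Defs
open import Data.Fin.Base using (Fin; zero; suc; _↑ˡ_; _↑ʳ_; splitAt; join; finToFun; funToFin)
open import Data.Fin.Properties as Fin
  using (all?; any?; finToFun-funToFin; join-splitAt; ↑ʳ-injective; inj⇒≟)
open import Data.List.Base as List using (List; []; _∷_; _++_; length; map; tabulate)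
open import Data.List.Membership.Propositional using (_∈_)
open import Data.List.Membership.Propositional.Properties using (∈-map⁺; ∈-allFin)
open import Data.List.Properties using (length-++; length-map; length-tabulate)
open import Data.List.Relation.Unary.All using (All; []; _∷_)
open import Data.List.Relation.Unary.Any using (here; there)
open import Data.Nat.Base using (ℕ; zero; suc; _+_; _^_; _≤_; z≤n; s≤s)
open import Data.Nat.Properties using (+-monoˡ-≤; +-suc; +-identityʳ; suc-injective)
open import Data.Product.Base using (∃; Σ; _×_; _,_; proj₁; proj₂)
open import Data.Sum.Base using (_⊎_; inj₁; inj₂)
open import Data.Vec.Base as Vec using (Vec; []; _∷_; lookup; take; drop; _[_]≔_)
open import Data.Vec.Properties
  using (lookup∘tabulate; tabulate∘lookup; tabulate-cong; lookup∘update; lookup∘update′;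
         []≔-idempotent; []≔-lookup; lookup-++ˡ; lookup-++ʳ; ++-injectiveˡ; ++-injectiveʳ;
         take++drop≡id; lookup-replicate; ≡-dec)
open import Function.Base using (id; _∘_)
open import Function.Bundles using (_↔_; module Inverse)
open import Function.Definitions using (Injective)
open import Function.Properties.Inverse using (↔⇒↣)
open import Level using (Level)
open import Relation.Binary.Definitions using (DecidableEquality)
open import Relation.Binary.PropositionalEquality
  using (_≡_; _≢_; _≗_; refl; sym; trans; cong; subst; module ≡-Reasoning)
open import Relation.Nullary.Decidable
  using (Dec; yes; no; map′; ¬?; _×-dec_; _→-dec_; decidable-stable)
open import Relation.Nullary.Negation using (¬_; contradiction)
open import Relation.Unary using (Decidable)

open ≡-Reasoning

private
  variable
    a p : Level
    A : Set a
    N n m : ℕ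

-- Least witnesses, vectors and their coordinates.

-- Linear search upwards from 0, bounded by the known witness `k`.
least : {P : ℕ → Set p} → Decidable P → ∀ k → P k → ∃ (IsMinimum P)
least P? zero    Pk = 0 , Pk , λ _ _ → z≤n
least P? (suc k) Pk with P? 0
... | yes P0 = 0 , P0 , λ _ _ → z≤n
... | no ¬P0 with l , Pl , min ← least (P? ∘ suc) k Pk
  = suc l , Pl , λ where
      zero    P0 → contradiction P0 ¬P0
      (suc j) Pj → s≤s (min j Pj)

lookup-ext : {xs ys : Vec A n} → lookup xs ≗ lookup ys → xs ≡ ys
lookup-ext {xs = xs} {ys} eq =
  trans (sym (tabulate∘lookup xs)) (trans (tabulate-cong eq) (tabulate∘lookup ys))

↑-cases : (P : Fin (n + m) → Set p) → (∀ i → P (i ↑ˡ m)) → (∀ i → P (n ↑ʳ i)) → ∀ i → P i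
↑-cases {n = n} {m} P l r i = subst P (join-splitAt n m i) (case (splitAt n i))
  where
  case : ∀ s → P (join n m s)
  case (inj₁ j) = l j
  case (inj₂ j) = r j

lookup-take : ∀ (xs : Vec A (n + m)) i → lookup (take n xs) i ≡ lookup xs (i ↑ˡ m)
lookup-take {n = n} xs i =
  trans (sym (lookup-++ˡ (take n xs) (drop n xs) i))
        (cong (λ ys → lookup ys (i ↑ˡ _)) (take++drop≡id n xs))

take-++ : ∀ (xs : Vec A n) (ys : Vec A m) → take n (xs Vec.++ ys) ≡ xs
take-++ xs ys = lookup-ext λ i → trans (lookup-take (xs Vec.++ ys) i) (lookup-++ˡ xs ys i)

≡-++ : ∀ (xs : Vec A (n + m)) (ys : Vec A n) (zs : Vec A m) →
       (∀ i → lookup xs (i ↑ˡ m) ≡ lookup ys i) → (∀ i → lookup xs (n ↑ʳ i) ≡ lookup zs i) →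
       xs ≡ ys Vec.++ zs
≡-++ xs ys zs l r = lookup-ext (↑-cases (λ i → lookup xs i ≡ lookup (ys Vec.++ zs) i)
  (λ i → trans (l i) (sym (lookup-++ˡ ys zs i)))
  (λ i → trans (r i) (sym (lookup-++ʳ ys zs i))))

-- The vector `y` arises from `x` by overwriting the entries one by one from the left; the finished
-- prefix is absorbed into `P`.
[]≔-induction : (P : Vec A N → Set p) → (∀ x i z → P x → P (x [ i ]≔ z)) →
                ∀ x y → P x → P y
[]≔-induction P step []       []       Px = Px
[]≔-induction P step (x ∷ xs) (y ∷ ys) Px =
  []≔-induction (P ∘ (y ∷_)) (λ zs i → step (y ∷ zs) (suc i)) xs ys (step (x ∷ xs) zero y Px)

D⇒take : ∀ (f : Transformation A n) h → D f m h → ∀ x → take n (h x) ≡ f (take n x)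
D⇒take f h d x = lookup-ext λ i → trans (lookup-take (h x) i) (d i x)

take⇒D : ∀ (f : Transformation A n) (h : Transformation A (n + m)) →
         (∀ x → take n (h x) ≡ f (take n x)) → D f m h
take⇒D f h eq i x = trans (sym (lookup-take (h x) i)) (cong (λ y → lookup y i) (eq x))

D-resp-≗ : ∀ (f : Transformation A n) {h h′} → h ≗ h′ → D f m h → D f m h′
D-resp-≗ f eq d i x = trans (cong (λ y → lookup y _) (sym (eq x))) (d i x)

-- Instructions and programs that write constants.

-- A nontrivial coordinate cannot differ from `i`, and equality of indices is stable under double
-- negation.
trivialOff⇒instruction : ∀ (g : Transformation A N) i →
                         (∀ j → j ≢ i → Trivial g j) → IsInstruction g
trivialOff⇒instruction g i off j k ¬j ¬k = trans (at-i ¬j) (sym (at-i ¬k))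
  where
  at-i : ∀ {j} → ¬ Trivial g j → j ≡ i
  at-i {j} ¬j = decidable-stable (j Fin.≟ i) (¬j ∘ off j)

overwrite : Fin N → A → Instruction A N
overwrite i z = (_[ i ]≔ z) , trivialOff⇒instruction (_[ i ]≔ z) i λ j j≢i x → lookup∘update′ j≢i x z

run-++ : ∀ (p r : Program A N) x → run (p ++ r) x ≡ run r (run p x)
run-++ []            r x = refl
run-++ ((g , _) ∷ p) r x = run-++ p r (g x)

assign : (Fin m → Fin N) → (Fin m → A) → Program A N
assign κ e = tabulate λ k → overwrite (κ k) (e k)

assign-off : ∀ (κ : Fin m → Fin N) (e : Fin m → A) x i → (∀ k → κ k ≢ i) →
             lookup (run (assign κ e) x) i ≡ lookup x i
assign-off {m = zero}  κ e x i κ≢i = refl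
assign-off {m = suc m} κ e x i κ≢i =
  trans (assign-off (κ ∘ suc) (e ∘ suc) _ i (κ≢i ∘ suc))
        (lookup∘update′ (κ≢i zero ∘ sym) x (e zero))

-- Injectivity of `κ` keeps the later assignments away from a cell once it is written.
assign-on : ∀ (κ : Fin m → Fin N) → Injective _≡_ _≡_ κ → ∀ (e : Fin m → A) x k →
            lookup (run (assign κ e) x) (κ k) ≡ e k
assign-on κ inj e x zero    =
  trans (assign-off (κ ∘ suc) (e ∘ suc) _ (κ zero) λ k eq → Fin.0≢1+n (sym (inj eq)))
        (lookup∘update (κ zero) x (e zero))
assign-on κ inj e x (suc k) = assign-on (κ ∘ suc) (Fin.suc-injective ∘ inj) (e ∘ suc) _ k

↑ˡ≢↑ʳ : ∀ (i : Fin n) (j : Fin m) → n ↑ʳ j ≢ i ↑ˡ m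
↑ˡ≢↑ʳ zero    j ()
↑ˡ≢↑ʳ (suc i) j eq = ↑ˡ≢↑ʳ i j (Fin.suc-injective eq)

length-assign : ∀ (κ : Fin m → Fin N) (e : Fin m → A) → length (assign κ e) ≡ m
length-assign κ e = length-tabulate λ k → overwrite (κ k) (e k)

setMemory : ∀ n → Vec A m → Program A (n + m)
setMemory n e = assign (n ↑ʳ_) (lookup e)

run-setMemory : ∀ (e : Vec A m) x → run (setMemory n e) x ≡ take n x Vec.++ e
run-setMemory {n = n} e x = ≡-++ _ (take n x) e
  (λ i → trans (assign-off (n ↑ʳ_) (lookup e) x (i ↑ˡ _) (↑ˡ≢↑ʳ i)) (sym (lookup-take x i)))
  (assign-on (n ↑ʳ_) (↑ʳ-injective n _ _) (lookup e) x)

-- Programs that ignore a cell.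

-- g with cell j read as c and never written.
freeze : Fin N → A → Instruction A N → Instruction A N
freeze {N = N} j c (g , inst) = g′ , inst′
  where
  g′ : Transformation _ N
  g′ x = g (x [ j ]≔ c) [ j ]≔ lookup x j

  trivial-j : Trivial g′ j
  trivial-j x = lookup∘update j (g (x [ j ]≔ c)) (lookup x j)

  trivial-off : ∀ {i} → i ≢ j → Trivial g i → Trivial g′ i
  trivial-off i≢j t x =
    trans (lookup∘update′ i≢j (g (x [ j ]≔ c)) (lookup x j))
          (trans (t (x [ j ]≔ c)) (lookup∘update′ i≢j x c))

  -- Freezing creates no new nontrivial coordinate, so the bound on their number is inherited.
  nontrivial : ∀ {i} → ¬ Trivial g′ i → ¬ Trivial g i
  nontrivial {i} ¬t t with i Fin.≟ j
  ... | yes refl = ¬t trivial-j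
  ... | no i≢j   = ¬t (trivial-off i≢j t)

  inst′ : IsInstruction g′
  inst′ i k ¬i ¬k = inst i k (nontrivial ¬i) (nontrivial ¬k)

TrivialAt : Fin N → Instruction A N → Set _
TrivialAt j (g , _) = Trivial g j

run-trivialAt : ∀ (p : Program A N) j → All (TrivialAt j) p → Trivial (run p) j
run-trivialAt []            j []       x = refl
run-trivialAt ((g , _) ∷ p) j (t ∷ ts) x = trans (run-trivialAt p j ts (g x)) (t x)

run-freeze : ∀ (p : Program A N) j c → All (TrivialAt j) p → ∀ x y →
             x [ j ]≔ c ≡ y → run (map (freeze j c) p) x [ j ]≔ c ≡ run p y
run-freeze []                j c []       x y x~y = x~y
run-freeze ((g , inst) ∷ p) j c (t ∷ ts) x y refl = run-freeze p j c ts _ (g y) (begin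
  g y [ j ]≔ lookup x j [ j ]≔ c  ≡⟨ []≔-idempotent (g y) j ⟩
  g y [ j ]≔ c                    ≡⟨ cong (g y [ j ]≔_) (trans (t y) (lookup∘update j x c)) ⟨
  g y [ j ]≔ lookup (g y) j       ≡⟨ []≔-lookup (g y) j ⟩
  g y                             ∎)

-- Exhaustive search over a finite alphabet.

module _ {a} {q : ℕ} {A : Set a} (A↔Fin : A ↔ Fin q) where

  open Inverse A↔Fin using (to; from; strictlyInverseˡ; strictlyInverseʳ)

  infix 4 _≟ᴬ_ _≟ⱽ_

  _≟ᴬ_ : DecidableEquality A
  _≟ᴬ_ = inj⇒≟ (↔⇒↣ A↔Fin)

  _≟ⱽ_ : DecidableEquality (Vec A N)
  _≟ⱽ_ = ≡-dec _≟ᴬ_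

  decodeⱽ : Fin (q ^ N) → Vec A N
  decodeⱽ k = Vec.tabulate (from ∘ finToFun k)

  encodeⱽ : Vec A N → Fin (q ^ N)
  encodeⱽ x = funToFin (to ∘ lookup x)

  decodeⱽ-encodeⱽ : (x : Vec A N) → decodeⱽ (encodeⱽ x) ≡ x
  decodeⱽ-encodeⱽ x = lookup-ext λ i → begin
    lookup (decodeⱽ (encodeⱽ x)) i
      ≡⟨ lookup∘tabulate _ i ⟩
    from (finToFun (funToFin (to ∘ lookup x)) i)
      ≡⟨ cong from (finToFun-funToFin (to ∘ lookup x) i) ⟩
    from (to (lookup x i))
      ≡⟨ strictlyInverseʳ (lookup x i) ⟩
    lookup x i                              ∎

  allⱽ? : {P : Vec A N → Set p} → Decidable P → Dec (∀ x → P x)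
  allⱽ? {P = P} P? = map′ (λ all x → subst P (decodeⱽ-encodeⱽ x) (all (encodeⱽ x)))
                          (_∘ decodeⱽ) (all? (P? ∘ decodeⱽ))

  decodeᵀ : Fin ((q ^ N) ^ (q ^ N)) → Transformation A N
  decodeᵀ k = decodeⱽ ∘ finToFun k ∘ encodeⱽ

  encodeᵀ : Transformation A N → Fin ((q ^ N) ^ (q ^ N))
  encodeᵀ g = funToFin (encodeⱽ ∘ g ∘ decodeⱽ)

  decodeᵀ-encodeᵀ : (g : Transformation A N) → decodeᵀ (encodeᵀ g) ≗ g
  decodeᵀ-encodeᵀ g x = begin
    decodeᵀ (encodeᵀ g) x
      ≡⟨ cong decodeⱽ (finToFun-funToFin (encodeⱽ ∘ g ∘ decodeⱽ) (encodeⱽ x)) ⟩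
    decodeⱽ (encodeⱽ (g (decodeⱽ (encodeⱽ x))))  ≡⟨ decodeⱽ-encodeⱽ _ ⟩
    g (decodeⱽ (encodeⱽ x))                      ≡⟨ cong g (decodeⱽ-encodeⱽ x) ⟩
    g x                                          ∎

  -- Decoding recovers a transformation only up to pointwise equality, which `P` therefore has to
  -- respect.
  anyᵀ? : {P : Transformation A N → Set p} → (∀ {g h} → g ≗ h → P g → P h) →
          Decidable P → Dec (∃ P)
  anyᵀ? resp P? = map′ (λ (k , Pk) → decodeᵀ k , Pk)
                       (λ (g , Pg) → encodeᵀ g , resp (sym ∘ decodeᵀ-encodeᵀ g) Pg)
                       (any? (P? ∘ decodeᵀ))

  trivial? : (g : Transformation A N) → Decidable (Trivial g)
  trivial? g i = allⱽ? λ x → lookup (g x) i ≟ᴬ lookup x i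

  isInstruction? : Decidable (IsInstruction {A = A} {N})
  isInstruction? g = all? λ i → all? λ j →
    ¬? (trivial? g i) →-dec ¬? (trivial? g j) →-dec (i Fin.≟ j)

  isInstruction-resp-≗ : {g h : Transformation A N} → g ≗ h → IsInstruction g → IsInstruction h
  isInstruction-resp-≗ {g = g} {h} eq inst i j ¬i ¬j = inst i j (¬i ∘ transfer i) (¬j ∘ transfer j)
    where
    transfer : ∀ i → Trivial g i → Trivial h i
    transfer i t x = trans (cong (λ y → lookup y i) (sym (eq x))) (t x)

  -- Induction on the length for all `P` at once: the first instruction `g` is searched for and then
  -- absorbed into the predicate for the remaining program.
  ∃-program? : (P : Transformation A N → Set p) → (∀ {g h} → g ≗ h → P g → P h) → Decidable P →
               ∀ l → Dec (Σ (Program A N) λ r → length r ≡ l × P (run r))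
  ∃-program? P resp P? zero    = map′ (λ Pid → [] , refl , Pid) (λ { ([] , _ , Pid) → Pid }) (P? id)
  ∃-program? {N = N} P resp P? (suc l) = map′ uncons⁻ uncons
    (anyᵀ? resp′ λ g → isInstruction? g ×-dec
      ∃-program? (λ h → P (h ∘ g)) (λ eq → resp (eq ∘ g)) (λ h → P? (h ∘ g)) l)
    where
    First : Transformation A N → Set _
    First g = IsInstruction g × Σ (Program A N) λ r → length r ≡ l × P (run r ∘ g)

    resp′ : ∀ {g h} → g ≗ h → First g → First h
    resp′ eq (inst , r , len , Pr) =
      isInstruction-resp-≗ eq inst , r , len , resp (cong (run r) ∘ eq) Pr

    uncons⁻ : ∃ First → Σ (Program A N) λ r → length r ≡ suc l × P (run r)
    uncons⁻ (g , inst , r , len , Pr) = (g , inst) ∷ r , cong suc len , Pr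

    uncons : (Σ (Program A N) λ r → length r ≡ suc l × P (run r)) → ∃ First
    uncons ((g , inst) ∷ r , len , Pr) = g , inst , r , suc-injective len , Pr

  D? : (f : Transformation A n) → Decidable (D f m)
  D? f h = all? λ i → allⱽ? λ x → lookup (h x) _ ≟ᴬ lookup (f (take _ x)) i

  -- Deleting writes to cells that end up constant.

  -- The tail is treated first, so the deleted write is the last one; the instructions behind it are
  -- frozen. They leave in cell `j` whatever was there, hence the update by `c` in the equation.
  dropLastWrite : ∀ (r : Program A N) j c → All (TrivialAt j) r ⊎
    Σ (Program A N) λ r′ → suc (length r′) ≡ length r ×
      (∀ x → lookup (run r x) j ≡ c → run r′ x [ j ]≔ c ≡ run r x)
  dropLastWrite []               j c = inj₁ []
  dropLastWrite ((g , inst) ∷ r) j c with dropLastWrite r j c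
  ... | inj₂ (r′ , len , eq) = inj₂ ((g , inst) ∷ r′ , cong suc len , eq ∘ g)
  ... | inj₁ ts with trivial? g j
  ...   | yes t = inj₁ (t ∷ ts)
  ...   | no ¬t = inj₂ (map (freeze j c) r , cong suc (length-map (freeze j c) r) ,
                        λ x eq → run-freeze r j c ts x (g x) (lookup-ext (agree x eq)))
    where
    -- The state after `g` is `x` with `c` in cell `j`: the tail preserves that cell and ends with
    -- `c` in it, and `g`, being nontrivial at `j`, is trivial elsewhere.
    agree : ∀ x → lookup (run r (g x)) j ≡ c → ∀ i → lookup (x [ j ]≔ c) i ≡ lookup (g x) i
    agree x eq i with i Fin.≟ j
    ... | yes refl = trans (lookup∘update j x c) (trans (sym eq) (run-trivialAt r j ts (g x)))
    ... | no i≢j   = trans (lookup∘update′ i≢j x c) (sym (trivial-i x))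
      where
      trivial-i : Trivial g i
      trivial-i = decidable-stable (trivial? g i) λ ¬i → i≢j (inst i j ¬i ¬t)

  distinct : 2 ≤ q → ∃ λ (x : A) → ∃ λ y → x ≢ y
  distinct (s≤s (s≤s _)) = from zero , from (suc zero) , λ eq →
    Fin.0≢1+n (trans (sym (strictlyInverseˡ zero))
                     (trans (cong to eq) (strictlyInverseˡ (suc zero))))

  module _ (2≤q : 2 ≤ q) where

    another : ∀ (c : A) → ∃ λ d → d ≢ c
    another c with x , y , x≢y ← distinct 2≤q with x ≟ᴬ c
    ... | yes x≡c = y , λ y≡c → x≢y (trans x≡c (sym y≡c))
    ... | no x≢c  = x , x≢c

    dropConstantCell : ∀ (r : Program A N) j c → (∀ x → lookup (run r x) j ≡ c) →
      Σ (Program A N) λ r′ → suc (length r′) ≡ length r ×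
        (∀ x i → i ≢ j → lookup (run r′ x) i ≡ lookup (run r x) i)
    dropConstantCell r j c const with dropLastWrite r j c
    ... | inj₂ (r′ , len , eq) = r′ , len , λ x i i≢j →
      trans (sym (lookup∘update′ i≢j (run r′ x) c)) (cong (λ y → lookup y i) (eq x (const x)))
    -- A cell that is never changed keeps its input, which can be chosen different from `c`.
    ... | inj₁ ts = contradiction d≡c (proj₂ (another c))
      where
      d = proj₁ (another c)
      x = Vec.replicate _ d

      d≡c : d ≡ c
      d≡c = begin
        d                   ≡⟨ lookup-replicate j d ⟨
        lookup x j          ≡⟨ run-trivialAt r j ts x ⟨
        lookup (run r x) j  ≡⟨ const x ⟩
        c                   ∎

    -- Deleting the write for `κ zero` preserves the final contents of all other cells; by
    -- injectivity the remaining cells of `κ` are still constant.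
    dropConstantCells : ∀ (κ : Fin m → Fin N) → Injective _≡_ _≡_ κ →
      ∀ (r : Program A N) (c : Fin m → A) →
      (∀ k x → lookup (run r x) (κ k) ≡ c k) →
      Σ (Program A N) λ r′ → length r′ + m ≡ length r ×
        (∀ x i → (∀ k → κ k ≢ i) → lookup (run r′ x) i ≡ lookup (run r x) i)
    dropConstantCells {m = zero}  κ inj r c const = r , +-identityʳ _ , λ _ _ _ → refl
    dropConstantCells {m = suc m} κ inj r c const
      with r₁ , len₁ , eq₁ ← dropConstantCell r (κ zero) (c zero) (const zero)
      with r₂ , len₂ , eq₂ ← dropConstantCells (κ ∘ suc) (Fin.suc-injective ∘ inj) r₁ (c ∘ suc)
             (λ k x → trans (eq₁ x (κ (suc k)) λ eq → Fin.0≢1+n (sym (inj eq))) (const (suc k) x))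
      = r₂ , trans (+-suc _ m) (trans (cong suc len₂) len₁) ,
        λ x i κ≢i → trans (eq₂ x i (κ≢i ∘ suc)) (eq₁ x i (κ≢i zero ∘ sym))

  -- Programs moving a single state.

  move : Vec A N → Vec A N → Transformation A N
  move b c x with x ≟ⱽ b
  ... | yes _ = c
  ... | no  _ = x

  move-≡ : ∀ (b c : Vec A N) → move b c b ≡ c
  move-≡ b c with b ≟ⱽ b
  ... | yes _  = refl
  ... | no b≢b = contradiction refl b≢b

  move-≢ : ∀ {b : Vec A N} c {x} → x ≢ b → move b c x ≡ x
  move-≢ {b = b} c {x} x≢b with x ≟ⱽ b
  ... | yes x≡b = contradiction x≡b x≢b
  ... | no _    = refl

  move-lookup : ∀ (b c : Vec A N) j → lookup c j ≡ lookup b j → Trivial (move b c) j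
  move-lookup b c j eq x with x ≟ⱽ b
  ... | yes refl = eq
  ... | no _     = refl

  swap : Vec A N → Vec A N → Transformation A N
  swap b c x with x ≟ⱽ b
  ... | yes _ = c
  ... | no  _ = move c b x

  swap-≡ˡ : ∀ (b c : Vec A N) → swap b c b ≡ c
  swap-≡ˡ b c with b ≟ⱽ b
  ... | yes _  = refl
  ... | no b≢b = contradiction refl b≢b

  swap-≡ʳ : ∀ (b c : Vec A N) → swap b c c ≡ b
  swap-≡ʳ b c with c ≟ⱽ b
  ... | yes c≡b = c≡b
  ... | no  _   = move-≡ c b

  swap-≢ : ∀ {b c x : Vec A N} → x ≢ b → x ≢ c → swap b c x ≡ x
  swap-≢ {b = b} {c} {x} x≢b x≢c with x ≟ⱽ b
  ... | yes x≡b = contradiction x≡b x≢b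
  ... | no  _   = move-≢ b x≢c

  swap-involutive : ∀ (b c x : Vec A N) → swap b c (swap b c x) ≡ x
  swap-involutive b c x = case (x ≟ⱽ b) (x ≟ⱽ c)
    where
    case : Dec (x ≡ b) → Dec (x ≡ c) → swap b c (swap b c x) ≡ x
    case (yes refl) _          = trans (cong (swap b c) (swap-≡ˡ b c)) (swap-≡ʳ b c)
    case (no _)     (yes refl) = trans (cong (swap b c) (swap-≡ʳ b c)) (swap-≡ˡ b c)
    case (no x≢b)   (no x≢c)   = trans (cong (swap b c) (swap-≢ x≢b x≢c)) (swap-≢ x≢b x≢c)

  swap-lookup : ∀ (b c : Vec A N) j → lookup c j ≡ lookup b j → Trivial (swap b c) j
  swap-lookup b c j eq x with x ≟ⱽ b
  ... | yes refl = eq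
  ... | no _     = move-lookup c b j (sym eq) x

  -- Conjugation by the transposition of `c` and `d`, which fixes `b`, turns the target `c` into
  -- `d`.
  swap-move-swap : ∀ {b c d : Vec A N} → b ≢ c → b ≢ d →
                   swap c d ∘ move b c ∘ swap c d ≗ move b d
  swap-move-swap {b = b} {c} {d} b≢c b≢d x with x ≟ⱽ b
  ... | yes refl = begin
    swap c d (move b c (swap c d b))  ≡⟨ cong (swap c d ∘ move b c) (swap-≢ b≢c b≢d) ⟩
    swap c d (move b c b)             ≡⟨ cong (swap c d) (move-≡ b c) ⟩
    swap c d c                        ≡⟨ swap-≡ˡ c d ⟩
    d                                 ∎
  ... | no x≢b = begin
    swap c d (move b c (swap c d x))  ≡⟨ cong (swap c d) (move-≢ c swap≢b) ⟩
    swap c d (swap c d x)             ≡⟨ swap-involutive c d x ⟩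
    x                                 ∎
    where
    swap≢b : swap c d x ≢ b
    swap≢b eq = x≢b (begin
      x                      ≡⟨ swap-involutive c d x ⟨
      swap c d (swap c d x)  ≡⟨ cong (swap c d) eq ⟩
      swap c d b             ≡⟨ swap-≢ b≢c b≢d ⟩
      b                      ∎)

  Computable : Transformation A N → Set a
  Computable {N = N} h = Σ (Program A N) (_Computes h)

  -- Change one coordinate of the target at a time; swap-move-swap needs only
  -- swaps of neighbours in the Hamming graph, which are instructions.
  move-computable : ∀ (b c : Vec A N) → Computable (move b c)
  move-computable b c = []≔-induction (Computable ∘ move b) step b c ([] , identity)
    where
    identity : ∀ x → x ≡ move b b x
    identity x with x ≟ⱽ b
    ... | yes x≡b = x≡b
    ... | no _    = refl

    step : ∀ c i z → Computable (move b c) → Computable (move b (c [ i ]≔ z))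
    step c i z (r , eq) = case (b ≟ⱽ c) (b ≟ⱽ d)
      where
      d = c [ i ]≔ z

      instruction : (g : Transformation A _) →
                    (∀ j → lookup d j ≡ lookup c j → Trivial g j) → Instruction A _
      instruction g t = g , trivialOff⇒instruction g i λ j j≢i → t j (lookup∘update′ j≢i c z)

      s : Instruction A _
      s = instruction (swap c d) (swap-lookup c d)

      -- Conjugation requires `b` to differ from `c` and `d`. If `b ≡ c`, the move is itself an
      -- instruction; if `b ≡ d`, it is the identity.
      case : Dec (b ≡ c) → Dec (b ≡ d) → Computable (move b d)
      case (yes refl) _        = instruction (move b d) (move-lookup b d) ∷ [] , λ _ → refl
      case (no _)    (yes b≡d) = [] , λ x → trans (identity x) (cong (λ d → move b d x) b≡d)
      case (no b≢c)  (no b≢d)  = s ∷ (r ++ s ∷ []) , λ x → begin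
        run (r ++ s ∷ []) (swap c d x)    ≡⟨ run-++ r (s ∷ []) (swap c d x) ⟩
        swap c d (run r (swap c d x))     ≡⟨ cong (swap c d) (eq (swap c d x)) ⟩
        swap c d (move b c (swap c d x))  ≡⟨ swap-move-swap b≢c b≢d x ⟩
        move b d x                        ∎

  -- A program for some element of `D f m`.

  module _ (f : Transformation A n) {z z′ : Vec A m} (z≢z′ : z ≢ z′) where

    -- The memory is a flag: `z` marks a state still to be transferred, `z′` one that is done.
    transfers : List (Vec A n) → Program A (n + m)
    transfers []       = []
    transfers (v ∷ vs) = proj₁ (move-computable (v Vec.++ z) (f v Vec.++ z′)) ++ transfers vs

    run-transfers : ∀ v vs x → run (transfers (v ∷ vs)) x ≡
                    run (transfers vs) (move (v Vec.++ z) (f v Vec.++ z′) x)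
    run-transfers v vs x with r , eq ← move-computable (v Vec.++ z) (f v Vec.++ z′) =
      trans (run-++ r (transfers vs) x) (cong (run (transfers vs)) (eq x))

    -- Every move starts from a state flagged `z`, so none affects a state flagged `z′`.
    transfers-fixed : ∀ vs y → run (transfers vs) (y Vec.++ z′) ≡ y Vec.++ z′
    transfers-fixed []       y = refl
    transfers-fixed (v ∷ vs) y = begin
      run (transfers (v ∷ vs)) (y Vec.++ z′)  ≡⟨ run-transfers v vs _ ⟩
      run (transfers vs) (move _ _ (y Vec.++ z′))
        ≡⟨ cong (run (transfers vs)) (move-≢ _ (z≢z′ ∘ sym ∘ ++-injectiveʳ y v)) ⟩
      run (transfers vs) (y Vec.++ z′)  ≡⟨ transfers-fixed vs y ⟩
      y Vec.++ z′  ∎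

    -- The first occurrence of `v` performs the transfer: earlier moves start from other vectors,
    -- and later ones fix the flagged result.
    transfers-∈ : ∀ {vs v} → v ∈ vs → run (transfers vs) (v Vec.++ z) ≡ f v Vec.++ z′
    transfers-∈ {w ∷ vs} {v} v∈ = trans (run-transfers w vs _) (case (v ≟ⱽ w) v∈)
      where
      case : Dec (v ≡ w) → v ∈ w ∷ vs → run (transfers vs)
               (move (w Vec.++ z) (f w Vec.++ z′) (v Vec.++ z)) ≡ f v Vec.++ z′
      case (yes refl) _ =
        trans (cong (run (transfers vs)) (move-≡ (w Vec.++ z) _)) (transfers-fixed vs (f v))
      case (no v≢w) (here v≡w) = contradiction v≡w v≢w
      case (no v≢w) (there v∈vs) =
        trans (cong (run (transfers vs)) (move-≢ _ (v≢w ∘ ++-injectiveˡ v w))) (transfers-∈ v∈vs)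

    ∃-program-D : Σ (Program A (n + m)) λ r → D f m (run r)
    ∃-program-D = setMemory n z ++ transfers vectors , take⇒D f _ λ x → begin
      take n (run (setMemory n z ++ transfers vectors) x)
        ≡⟨ cong (take n) (run-++ (setMemory n z) (transfers vectors) x) ⟩
      take n (run (transfers vectors) (run (setMemory n z) x))
        ≡⟨ cong (take n ∘ run (transfers vectors)) (run-setMemory z x) ⟩
      take n (run (transfers vectors) (take n x Vec.++ z))
        ≡⟨ cong (take n) (transfers-∈ (∈-vectors (take n x))) ⟩
      take n (f (take n x) Vec.++ z′)
        ≡⟨ take-++ (f (take n x)) z′ ⟩
      f (take n x) ∎
      where
      vectors : List (Vec A n)
      vectors = map decodeⱽ (List.allFin (q ^ n))

      ∈-vectors : ∀ v → v ∈ vectors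
      ∈-vectors v = subst (_∈ vectors) (decodeⱽ-encodeⱽ v) (∈-map⁺ decodeⱽ (∈-allFin (encodeⱽ v)))

-- Existence of the minimum and the two bounds.

proposition10 : ∀ {a} (A : Set a) (q : ℕ) → A ↔ Fin q → 2 ≤ q →
    ∀ (n m : ℕ) → 2 ≤ n → 1 ≤ m →
    ∀ (f : Transformation A n) (e : Vec A m) (hᵉ : Transformation A (n + m)) →
    D f m hᵉ →
    (∀ (i : Fin m) x → coordinate hᵉ (n ↑ʳ i) x ≡ lookup e i) →
    ∃ λ l → (𝓛[ f ∣ m ]≡ l) × (𝓛[ hᵉ ]≡ (l + m))
proposition10 A q A↔Fin 2≤q n m@(suc _) 2≤n 1≤m f e hᵉ hᵉ∈D hᵉ-const
  with z , z′ , z≢z′ ← distinct A↔Fin 2≤q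
  -- The memory is nonempty, so two constant vectors with different entries differ in their heads.
  with r₀ , r₀∈D ← ∃-program-D A↔Fin f {Vec.replicate m z} {Vec.replicate m z′} (z≢z′ ∘ cong Vec.head)
  -- Minimising directly over programs that run in `D f m` gives the same `l` as minimising over `h`
  -- and then over its programs; `length r₀` bounds the search.
  with l , (r , refl , r∈D) , l-min ←
         least (∃-program? A↔Fin (D f m) (D-resp-≗ f) (D? A↔Fin f)) (length r₀) (r₀ , refl , r₀∈D)
  = l , ((run r , r∈D , (r , refl , λ _ → refl) , minimal-run) , minimal-D) ,
        ((r ++ setMemory n e , length-r++ , computes-hᵉ) , minimal-hᵉ)
  where
  -- Any program for `run r` also competes in the minimum over `D f m`, so `r` is shortest for its
  -- own transformation.
  minimal-run : ∀ k → (Σ (Program A (n + m)) λ s → length s ≡ k × s Computes run r) → l ≤ k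
  minimal-run k (s , len , eq) = l-min k (s , len , D-resp-≗ f (sym ∘ eq) r∈D)

  minimal-D : ∀ k → (∃ λ h → D f m h × 𝓛[ h ]≡ k) → l ≤ k
  minimal-D k (h , h∈D , (s , len , eq) , _) = l-min k (s , len , D-resp-≗ f (sym ∘ eq) h∈D)

  length-r++ : length (r ++ setMemory n e) ≡ l + m
  length-r++ = trans (length-++ r) (cong (l +_) (length-assign (n ↑ʳ_) (lookup e)))

  computes-hᵉ : (r ++ setMemory n e) Computes hᵉ
  computes-hᵉ x = begin
    run (r ++ setMemory n e) x       ≡⟨ run-++ r (setMemory n e) x ⟩
    run (setMemory n e) (run r x)    ≡⟨ run-setMemory e (run r x) ⟩
    take n (run r x) Vec.++ e        ≡⟨ cong (Vec._++ e) (D⇒take f (run r) r∈D x) ⟩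
    f (take n x) Vec.++ e            ≡⟨ ≡-++ (hᵉ x) _ e (λ i → hᵉ∈D i x) (λ i → hᵉ-const i x) ⟨
    hᵉ x                             ∎

  minimal-hᵉ : ∀ k → (Σ (Program A (n + m)) λ s → length s ≡ k × s Computes hᵉ) → l + m ≤ k
  minimal-hᵉ k (s , refl , eq)
    -- Removing one write per memory cell saves `m` instructions and keeps the first `n`
    -- coordinates, so `s′` still computes an element of `D f m`.
    with s′ , len , eq′ ← dropConstantCells A↔Fin 2≤q (n ↑ʳ_) (↑ʳ-injective n _ _) s (lookup e)
           (λ i x → trans (cong (λ y → lookup y (n ↑ʳ i)) (eq x)) (hᵉ-const i x))
    = subst (l + m ≤_) len (+-monoˡ-≤ m (l-min (length s′) (s′ , refl , s′∈D)))
    where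
    s′∈D : D f m (run s′)
    s′∈D i x = begin
      lookup (run s′ x) (i ↑ˡ m)  ≡⟨ eq′ x (i ↑ˡ m) (↑ˡ≢↑ʳ i) ⟩
      lookup (run s x) (i ↑ˡ m)   ≡⟨ cong (λ y → lookup y (i ↑ˡ m)) (eq x) ⟩
      lookup (hᵉ x) (i ↑ˡ m)      ≡⟨ hᵉ∈D i x ⟩
      lookup (f (take n x)) i     ∎
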